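{- Consider the translation of $\mathsf{CL}_{\rm b}$ to $\mathsf{CLL}_{\rm b}$ obtained by composing the Gödel-Gentzen translation $(\cdot)^{\rm G}$ with Girard's call-by-name translation $(\cdot)^\circ$, i.e. $A\mapsto(A^{\rm G})^\circ$. This composition can be presented in a modular (and simpler) way as $A\mapsto\,!A_{{\rm G}\circ}$, i.e. for every formula $A$ of the language of $\mathsf{ILL}_\bot$ the formulas $(A^{\rm G})^\circ$ and $!A_{{\rm G}\circ}$ are provably equivalent in $\mathsf{CLL}_{\rm b}$, where $A_{{\rm G}\circ}$ is defined inductively by: $P_{{\rm G}\circ}:=\,?!P$ for $P$ atomic; $(A\otimes B)_{{\rm G}\circ}:=\,!A_{{\rm G}\circ}\otimes\,!B_{{\rm G}\circ}$; $(A\& B)_{{\rm G}\circ}:=A_{{\rm G}\circ}\& B_{{\rm G}\circ}$; $(A\oplus B)_{{\rm G}\circ}:=\,?(!A_{{\rm G}\circ}\oplus\,!B_{{\rm G}\circ})$; $(A\multimap B)_{{\rm G}\circ}:=\,!A_{{\rm G}\circ}\multimap B_{{\rm G}\circ}$; $(\forall xA)_{{\rm G}\circ}:=\forall xA_{{\rm G}\circ}$; $(\exists xA)_{{\rm G}\circ}:=\,?\exists x\,!A_{{\rm G}\circ}$; $(!A)_{{\rm G}\circ}:=\,!A_{{\rm G}\circ}$.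
   Context: Intuitionistic linear logic $\mathsf{ILL}$ (first order). Formulas are built from atomic formulas, including the constants $1,\top,0$, using $\otimes,\&,\oplus,\multimap$, $\forall x,\exists x$ and $!$. Sequents are $\Gamma\vdash A$ with $\Gamma$ a finite multiset of formulas and exactly one formula on the right. Axioms: $A\vdash A$; $\vdash 1$; $\Gamma\vdash\top$; $\Gamma,0\vdash C$. Rules (premises $\Rightarrow$ conclusion): (cut) $\Gamma\vdash A;\ \Delta,A\vdash C\Rightarrow\Gamma,\Delta\vdash C$; $\Gamma\vdash C\Rightarrow\Gamma,1\vdash C$; $\Gamma\vdash A;\ \Delta\vdash B\Rightarrow\Gamma,\Delta\vdash A\otimes B$; $\Gamma,A,B\vdash C\Rightarrow\Gamma,A\otimes B\vdash C$; $\Gamma,A\vdash B\Rightarrow\Gamma\vdash A\multimap B$; $\Gamma\vdash A;\ \Delta,B\vdash C\Rightarrow\Gamma,\Delta,A\multimap B\vdash C$; $\Gamma\vdash A;\ \Gamma\vdash B\Rightarrow\Gamma\vdash A\& B$; $\Gamma,A\vdash C\Rightarrow\Gamma,A\& B\vdash C$; $\Gamma,B\vdash C\Rightarrow\Gamma,A\& B\vdash C$; $\Gamma\vdash A\Rightarrow\Gamma\vdash A\oplus B$; $\Gamma\vdash B\Rightarrow\Gamma\vdash A\oplus B$; $\Gamma,A\vdash C;\ \Gamma,B\vdash C\Rightarrow\Gamma,A\oplus B\vdash C$; $\Gamma\vdash A\Rightarrow\Gamma\vdash\forall xA$; $\Gamma,A[t/x]\vdash C\Rightarrow\Gamma,\forall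 xA\vdash C$; $\Gamma\vdash A[t/x]\Rightarrow\Gamma\vdash\exists xA$; $\Gamma,A\vdash C\Rightarrow\Gamma,\exists xA\vdash C$ (usual eigenvariable conditions); $\Gamma,!A,!A\vdash C\Rightarrow\Gamma,!A\vdash C$; $\Gamma\vdash C\Rightarrow\Gamma,!A\vdash C$; $!\Gamma\vdash A\Rightarrow\,!\Gamma\vdash\,!A$; $\Gamma,A\vdash C\Rightarrow\Gamma,!A\vdash C$. $\mathsf{ILL}_\bot$ extends $\mathsf{ILL}$ by one more constant $\bot$ (also counted as atomic); its sequents have at most one formula on the right (so $C$ in the rules above may be absent), and it has the additional axiom $\bot\vdash$ and rule $\Gamma\vdash\ \Rightarrow\Gamma\vdash\bot$. $\neg A:=A\multimap\bot$ and $?A:=\neg\,!\,\neg A$. $\mathsf{PRO}$: $A\vdash\,!A$; $\mathsf{DNE}$: $\neg\neg A\vdash A$ (axiom schemas). $\mathsf{CLL}_{\rm b}:=\mathsf{ILL}_\bot+\mathsf{DNE}$; $\mathsf{CL}_{\rm b}:=\mathsf{ILL}_\bot+\mathsf{PRO}+\mathsf{DNE}$. Formulas $A,B$ are provably equivalent in $S$ if $S$ proves $(A\multimap B)\&(B\multimap A)$. Gödel-Gentzen translation: $P^{\rm G}:=\neg\neg P$ ($P$ atomic); $(A\,\square\,B)^{\rm G}:=A^{\rm G}\,\square\,B^{\rm G}$ for $\square\in\{\otimes,\&,\multimap\}$; $(A\oplus B)^{\rm G}:=\neg\neg(A^{\rm G}\oplus B^{\rm G})$; $(\forall xA)^{\rm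 G}:=\forall xA^{\rm G}$; $(\exists xA)^{\rm G}:=\neg\neg\exists xA^{\rm G}$; $(!A)^{\rm G}:=\,!A^{\rm G}$. Call-by-name translation: $A^\circ:=\,!A_\circ$ where $P_\circ:=P$ ($P$ atomic); $(A\otimes B)_\circ:=\,!A_\circ\otimes\,!B_\circ$; $(A\& B)_\circ:=A_\circ\& B_\circ$; $(A\oplus B)_\circ:=\,!A_\circ\oplus\,!B_\circ$; $(A\multimap B)_\circ:=\,!A_\circ\multimap B_\circ$; $(\forall xA)_\circ:=\forall xA_\circ$; $(\exists xA)_\circ:=\exists x\,!A_\circ$; $(!A)_\circ:=\,!A_\circ$. -}

module Defs where

open import Data.List using (List; []; _∷_; [_]; _++_; map)
open import Data.List.Relation.Binary.Permutation.Propositional using (_↭_)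
open import Data.Maybe as Maybe using (Maybe; just; nothing)
open import Data.Nat using (ℕ; zero; suc)
open import Data.Vec using (Vec; []; _∷_)

record Signature : Set₁ where
  field
    Fun      : Set
    funArity : Fun → ℕ
    Rel      : Set
    relArity : Rel → ℕ

open Signature public

variable
  L : Signature

-- Variables are de Bruijn indices, so formulas are taken up to renaming of
-- bound variables.  Indices are unbounded rather than scoped by `Fin n`: as in
-- the usual named syntax, there are infinitely many free variables, and hence
-- always a term with which to instantiate a quantifier.
data Term (L : Signature) : Set where
  var : ℕ → Term L
  fun : (f : Fun L) → Vec (Term L) (funArity L f) → Term L

data Atom (L : Signature) : Set where
  rel                : (R : Rel L) → Vec (Term L) (relArity L R) → Atom L
  one top zero′ bot  : Atom L

infixr 8 _⊗_ _&_ _⊕_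
infixr 7 _⊸_
infix  9 !_ ⁇_ ¬_

data Formula (L : Signature) : Set where
  atom            : Atom L → Formula L
  _⊗_ _&_ _⊕_ _⊸_ : Formula L → Formula L → Formula L
  all ex          : Formula L → Formula L
  !_              : Formula L → Formula L

pattern 𝟏 = atom one
pattern ⊤ = atom top
pattern 𝟎 = atom zero′
pattern ⊥ = atom bot

¬_ : Formula L → Formula L
¬ A = A ⊸ ⊥

-- The exponential "why not"; a bare question mark is reserved by Agda.
⁇_ : Formula L → Formula L
⁇ A = ¬ (! (¬ A))

Subst : Signature → Set
Subst L = ℕ → Term L

mutual
  subTerm : Subst L → Term L → Term L
  subTerm σ (var x)    = σ x
  subTerm σ (fun f ts) = fun f (subTerms σ ts)

  subTerms : ∀ {n} → Subst L → Vec (Term L) n → Vec (Term L) n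
  subTerms σ []       = []
  subTerms σ (t ∷ ts) = subTerm σ t ∷ subTerms σ ts

↑ : Subst L
↑ x = var (suc x)

lift : Subst L → Subst L
lift σ zero    = var zero
lift σ (suc x) = subTerm ↑ (σ x)

subAtom : Subst L → Atom L → Atom L
subAtom σ (rel R ts) = rel R (subTerms σ ts)
subAtom σ one        = one
subAtom σ top        = top
subAtom σ zero′      = zero′
subAtom σ bot        = bot

sub : Subst L → Formula L → Formula L
sub σ (atom P) = atom (subAtom σ P)
sub σ (A ⊗ B)  = sub σ A ⊗ sub σ B
sub σ (A & B)  = sub σ A & sub σ B
sub σ (A ⊕ B)  = sub σ A ⊕ sub σ B
sub σ (A ⊸ B)  = sub σ A ⊸ sub σ B
sub σ (all A)  = all (sub (lift σ) A)
sub σ (ex A)   = ex (sub (lift σ) A)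
sub σ (! A)    = ! (sub σ A)

shift : Formula L → Formula L
shift = sub ↑

inst : Term L → Subst L
inst t zero    = t
inst t (suc x) = var x

infix 10 _[_/0]

_[_/0] : Formula L → Term L → Formula L
A [ t /0] = sub (inst t) A

-- `Schema L` is a set of axioms A ⊢ B.
Schema : Signature → Set₁
Schema L = Formula L → Formula L → Set

infix 3 _∣_⊢_

-- `S ∣ Γ ⊢ C` is derivability in ILL⊥ extended by the axioms in S; the
-- succedent is `nothing` when the right-hand side is empty.  Antecedents are
-- multisets, represented by lists together with the rule `exch`.  Shifting the
-- side formulas in `∀R` and `∃L` makes index 0 fresh for them, which is the
-- eigenvariable condition.
data _∣_⊢_ (S : Schema L) : List (Formula L) → Maybe (Formula L) → Set where
  exch : ∀ {Γ Δ C} → Γ ↭ Δ → S ∣ Γ ⊢ C → S ∣ Δ ⊢ C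

  ax   : ∀ {A B} → S A B → S ∣ [ A ] ⊢ just B

  id   : ∀ {A} → S ∣ [ A ] ⊢ just A
  cut  : ∀ {Γ Δ A C} → S ∣ Γ ⊢ just A → S ∣ A ∷ Δ ⊢ C → S ∣ Γ ++ Δ ⊢ C

  𝟏R   : S ∣ [] ⊢ just 𝟏
  𝟏L   : ∀ {Γ C} → S ∣ Γ ⊢ C → S ∣ 𝟏 ∷ Γ ⊢ C
  ⊤R   : ∀ {Γ} → S ∣ Γ ⊢ just ⊤
  𝟎L   : ∀ {Γ C} → S ∣ 𝟎 ∷ Γ ⊢ C
  ⊥L   : S ∣ [ ⊥ ] ⊢ nothing
  ⊥R   : ∀ {Γ} → S ∣ Γ ⊢ nothing → S ∣ Γ ⊢ just ⊥

  ⊗R   : ∀ {Γ Δ A B} → S ∣ Γ ⊢ just A → S ∣ Δ ⊢ just B → S ∣ Γ ++ Δ ⊢ just (A ⊗ B)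
  ⊗L   : ∀ {Γ A B C} → S ∣ A ∷ B ∷ Γ ⊢ C → S ∣ A ⊗ B ∷ Γ ⊢ C

  ⊸R   : ∀ {Γ A B} → S ∣ A ∷ Γ ⊢ just B → S ∣ Γ ⊢ just (A ⊸ B)
  ⊸L   : ∀ {Γ Δ A B C} → S ∣ Γ ⊢ just A → S ∣ B ∷ Δ ⊢ C → S ∣ A ⊸ B ∷ Γ ++ Δ ⊢ C

  &R   : ∀ {Γ A B} → S ∣ Γ ⊢ just A → S ∣ Γ ⊢ just B → S ∣ Γ ⊢ just (A & B)
  &L₁  : ∀ {Γ A B C} → S ∣ A ∷ Γ ⊢ C → S ∣ A & B ∷ Γ ⊢ C
  &L₂  : ∀ {Γ A B C} → S ∣ B ∷ Γ ⊢ C → S ∣ A & B ∷ Γ ⊢ C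

  ⊕R₁  : ∀ {Γ A B} → S ∣ Γ ⊢ just A → S ∣ Γ ⊢ just (A ⊕ B)
  ⊕R₂  : ∀ {Γ A B} → S ∣ Γ ⊢ just B → S ∣ Γ ⊢ just (A ⊕ B)
  ⊕L   : ∀ {Γ A B C} → S ∣ A ∷ Γ ⊢ C → S ∣ B ∷ Γ ⊢ C → S ∣ A ⊕ B ∷ Γ ⊢ C

  ∀R   : ∀ {Γ A} → S ∣ map shift Γ ⊢ just A → S ∣ Γ ⊢ just (all A)
  ∀L   : ∀ {Γ A C} (t : Term L) → S ∣ A [ t /0] ∷ Γ ⊢ C → S ∣ all A ∷ Γ ⊢ C
  ∃R   : ∀ {Γ A} (t : Term L) → S ∣ Γ ⊢ just (A [ t /0]) → S ∣ Γ ⊢ just (ex A)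
  ∃L   : ∀ {Γ A C} → S ∣ A ∷ map shift Γ ⊢ Maybe.map shift C → S ∣ ex A ∷ Γ ⊢ C

  !C   : ∀ {Γ A C} → S ∣ ! A ∷ ! A ∷ Γ ⊢ C → S ∣ ! A ∷ Γ ⊢ C
  !W   : ∀ {Γ A C} → S ∣ Γ ⊢ C → S ∣ ! A ∷ Γ ⊢ C
  !R   : ∀ {Γ A} → S ∣ map !_ Γ ⊢ just A → S ∣ map !_ Γ ⊢ just (! A)
  !L   : ∀ {Γ A C} → S ∣ A ∷ Γ ⊢ C → S ∣ ! A ∷ Γ ⊢ C

ProvablyEquivalent : Schema L → Formula L → Formula L → Set
ProvablyEquivalent S A B = S ∣ [] ⊢ just ((A ⊸ B) & (B ⊸ A))

data DNE {L : Signature} : Schema L where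
  dne : ∀ {A} → DNE (¬ (¬ A)) A

-- The extension of ILL⊥ by double-negation elimination.
CLLb : Schema L
CLLb = DNE

infix 10 _ᴳ _ₒ _° _ᴳₒ

-- Gödel–Gentzen translation.
_ᴳ : Formula L → Formula L
(atom P) ᴳ = ¬ (¬ (atom P))
(A ⊗ B) ᴳ  = (A ᴳ) ⊗ (B ᴳ)
(A & B) ᴳ  = (A ᴳ) & (B ᴳ)
(A ⊕ B) ᴳ  = ¬ (¬ ((A ᴳ) ⊕ (B ᴳ)))
(A ⊸ B) ᴳ  = (A ᴳ) ⊸ (B ᴳ)
(all A) ᴳ  = all (A ᴳ)
(ex A) ᴳ   = ¬ (¬ (ex (A ᴳ)))
(! A) ᴳ    = ! (A ᴳ)

-- Girard's call-by-name translation is _°, with _ₒ as its auxiliary.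
_ₒ : Formula L → Formula L
(atom P) ₒ = atom P
(A ⊗ B) ₒ  = ! (A ₒ) ⊗ ! (B ₒ)
(A & B) ₒ  = (A ₒ) & (B ₒ)
(A ⊕ B) ₒ  = ! (A ₒ) ⊕ ! (B ₒ)
(A ⊸ B) ₒ  = ! (A ₒ) ⊸ (B ₒ)
(all A) ₒ  = all (A ₒ)
(ex A) ₒ   = ex (! (A ₒ))
(! A) ₒ    = ! (A ₒ)

_° : Formula L → Formula L
A ° = ! (A ₒ)

_ᴳₒ : Formula L → Formula L
(atom P) ᴳₒ = ⁇ (! (atom P))
(A ⊗ B) ᴳₒ  = ! (A ᴳₒ) ⊗ ! (B ᴳₒ)
(A & B) ᴳₒ  = (A ᴳₒ) & (B ᴳₒ)
(A ⊕ B) ᴳₒ  = ⁇ (! (A ᴳₒ) ⊕ ! (B ᴳₒ))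
(A ⊸ B) ᴳₒ  = ! (A ᴳₒ) ⊸ (B ᴳₒ)
(all A) ᴳₒ  = all (A ᴳₒ)
(ex A) ᴳₒ   = ⁇ (ex (! (A ᴳₒ)))
(! A) ᴳₒ    = ! (A ᴳₒ)

{-# OPTIONS --safe #-}
module Submission where

open import Defs
open import Data.List using ([]; [_])
open import Data.List.Relation.Binary.Permutation.Propositional using (↭-refl; swap)
open import Data.Maybe using (just)
open import Data.Nat using (zero; suc)
open import Data.Product using (_×_; _,_)
open import Data.Vec using (Vec; []; _∷_)
open import Relation.Binary.PropositionalEquality
  using (_≡_; refl; sym; trans; cong; cong₂; subst)

-- Since (¬ X)ₒ is literally ¬ ! Xₒ, a double negation inserted by the
-- Gödel–Gentzen translation becomes ⁇ ! under call-by-name.  So (A ᴳ)ₒ and A ᴳₒ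
-- differ only in an additional ! on the formulas ! B ⊕ ! C and ∃x ! B, each of
-- which already entails its own !.  The equivalence then follows by congruence.

mutual
  -- `ρ` is compared with the composite only pointwise, so it can be chosen to suit: `var` when the
  -- substitutions cancel, a common composite in `lift-↑`.
  subTerm-∘ : {σ τ ρ : Subst L} → (∀ x → subTerm τ (σ x) ≡ ρ x) →
              ∀ t → subTerm τ (subTerm σ t) ≡ subTerm ρ t
  subTerm-∘ eq (var x)    = eq x
  subTerm-∘ eq (fun f ts) = cong (fun f) (subTerms-∘ eq ts)

  subTerms-∘ : {σ τ ρ : Subst L} → (∀ x → subTerm τ (σ x) ≡ ρ x) →
               ∀ {n} (ts : Vec (Term L) n) → subTerms τ (subTerms σ ts) ≡ subTerms ρ ts
  subTerms-∘ eq []       = refl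
  subTerms-∘ eq (t ∷ ts) = cong₂ _∷_ (subTerm-∘ eq t) (subTerms-∘ eq ts)

mutual
  subTerm-var : (t : Term L) → subTerm var t ≡ t
  subTerm-var (var x)    = refl
  subTerm-var (fun f ts) = cong (fun f) (subTerms-var ts)

  subTerms-var : ∀ {n} (ts : Vec (Term L) n) → subTerms var ts ≡ ts
  subTerms-var []       = refl
  subTerms-var (t ∷ ts) = cong₂ _∷_ (subTerm-var t) (subTerms-var ts)

-- This pointwise condition is preserved by `lift`, which lets cancellation pass under quantifiers.
LeftInverse : Subst L → Subst L → Set
LeftInverse τ σ = ∀ x → subTerm τ (σ x) ≡ var x

-- Both sides come from the single substitution sending `x` to `subTerm ↑ (τ x)`.
lift-↑ : (τ : Subst L) (t : Term L) → subTerm (lift τ) (subTerm ↑ t) ≡ subTerm ↑ (subTerm τ t)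
lift-↑ τ t = trans (subTerm-∘ (λ _ → refl) t) (sym (subTerm-∘ (λ _ → refl) t))

lift-leftInverse : {τ σ : Subst L} → LeftInverse τ σ → LeftInverse (lift τ) (lift σ)
lift-leftInverse inv zero    = refl
lift-leftInverse {τ = τ} {σ} inv (suc x) = trans (lift-↑ τ (σ x)) (cong (subTerm ↑) (inv x))

subAtom-leftInverse : {τ σ : Subst L} → LeftInverse τ σ → ∀ P → subAtom τ (subAtom σ P) ≡ P
subAtom-leftInverse inv (rel R ts) = cong (rel R) (trans (subTerms-∘ inv ts) (subTerms-var ts))
subAtom-leftInverse inv one        = refl
subAtom-leftInverse inv top        = refl
subAtom-leftInverse inv zero′      = refl
subAtom-leftInverse inv bot        = refl

sub-leftInverse : {τ σ : Subst L} → LeftInverse τ σ → ∀ A → sub τ (sub σ A) ≡ A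
sub-leftInverse inv (atom P) = cong atom (subAtom-leftInverse inv P)
sub-leftInverse inv (A ⊗ B)  = cong₂ _⊗_ (sub-leftInverse inv A) (sub-leftInverse inv B)
sub-leftInverse inv (A & B)  = cong₂ _&_ (sub-leftInverse inv A) (sub-leftInverse inv B)
sub-leftInverse inv (A ⊕ B)  = cong₂ _⊕_ (sub-leftInverse inv A) (sub-leftInverse inv B)
sub-leftInverse inv (A ⊸ B)  = cong₂ _⊸_ (sub-leftInverse inv A) (sub-leftInverse inv B)
sub-leftInverse inv (all A)  = cong all (sub-leftInverse (lift-leftInverse inv) A)
sub-leftInverse inv (ex A)   = cong ex (sub-leftInverse (lift-leftInverse inv) A)
sub-leftInverse inv (! A)    = cong !_ (sub-leftInverse inv A)

-- `sub (lift ↑) A` is the body of `shift (all A)`; instantiating it with the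
-- eigenvariable gives back A.
inst-eigenvariable : (A : Formula L) → sub (lift ↑) A [ var 0 /0] ≡ A
inst-eigenvariable = sub-leftInverse λ { zero → refl ; (suc x) → refl }

private
  variable
    S : Schema L
    A A′ B B′ C : Formula L

Entails : Schema L → Formula L → Formula L → Set
Entails S A B = S ∣ [ A ] ⊢ just B

Entails-trans : Entails S A B → Entails S B C → Entails S A C
Entails-trans = cut

!-mono : Entails S A B → Entails S (! A) (! B)
!-mono {A = A} d = !R {Γ = [ A ]} (!L d)

⊗-mono : Entails S A A′ → Entails S B B′ → Entails S (A ⊗ B) (A′ ⊗ B′)
⊗-mono d e = ⊗L (⊗R d e)

&-mono : Entails S A A′ → Entails S B B′ → Entails S (A & B) (A′ & B′)
&-mono d e = &R (&L₁ d) (&L₂ e)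

⊕-mono : Entails S A A′ → Entails S B B′ → Entails S (A ⊕ B) (A′ ⊕ B′)
⊕-mono d e = ⊕L (⊕R₁ d) (⊕R₂ e)

⊸-mono : Entails S A′ A → Entails S B B′ → Entails S (A ⊸ B) (A′ ⊸ B′)
-- `⊸L` puts the implication first, whereas `⊸R` discharges the head of the antecedent.
⊸-mono d e = ⊸R (exch (swap _ _ ↭-refl) (⊸L d e))

-- The argument of `⁇` lies under two negations, so the two reversals cancel.
⁇-mono : Entails S A B → Entails S (⁇ A) (⁇ B)
⁇-mono d = ⊸-mono (!-mono (⊸-mono d id)) id

-- Meets the shifted antecedent left by `∀R`: index 0 of `d` already serves as the eigenvariable, so
-- `d` is reused without renaming.
∀L-eigenvariable : Entails S A B → Entails S (shift (all A)) B
∀L-eigenvariable {S = S} {A} {B} d =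
  ∀L (var 0) (subst (λ X → Entails S X B) (sym (inst-eigenvariable A)) d)

-- The counterpart for the succedent shifted by `∃L`, with the eigenvariable as witness.
∃R-eigenvariable : Entails S A B → Entails S A (shift (ex B))
∃R-eigenvariable {S = S} {A} {B} d =
  ∃R (var 0) (subst (Entails S A) (sym (inst-eigenvariable B)) d)

all-mono : Entails S A B → Entails S (all A) (all B)
all-mono d = ∀R (∀L-eigenvariable d)

ex-mono : Entails S A B → Entails S (ex A) (ex B)
ex-mono d = ∃L (∃R-eigenvariable d)

-- After the case split the antecedent is a single `!` formula, so promotion applies.
!⊕!-promote : Entails S (! A ⊕ ! B) (! (! A ⊕ ! B))
!⊕!-promote {A = A} {B} = ⊕L (!R {Γ = [ A ]} (⊕R₁ id)) (!R {Γ = [ B ]} (⊕R₂ id))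

ex!-promote : Entails S (ex (! A)) (! (ex (! A)))
ex!-promote {A = A} = ∃L (!R {Γ = [ A ]} (∃R-eigenvariable id))

Equivalent : Schema L → Formula L → Formula L → Set
Equivalent S A B = Entails S A B × Entails S B A

Equivalent⇒ProvablyEquivalent : Equivalent S A B → ProvablyEquivalent S A B
Equivalent⇒ProvablyEquivalent (d , e) = &R (⊸R d) (⊸R e)

-- Both directions are proved together because `⊸` reverses entailment in its first argument.
ᴳ-ₒ-equivalent : (A : Formula L) → Equivalent S ((A ᴳ) ₒ) (A ᴳₒ)
ᴳ-ₒ-equivalent (atom P) = id , id
ᴳ-ₒ-equivalent (A ⊗ B)  with ᴳ-ₒ-equivalent A | ᴳ-ₒ-equivalent B
... | a , a′ | b , b′ = ⊗-mono (!-mono a) (!-mono b) , ⊗-mono (!-mono a′) (!-mono b′)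
ᴳ-ₒ-equivalent (A & B)  with ᴳ-ₒ-equivalent A | ᴳ-ₒ-equivalent B
... | a , a′ | b , b′ = &-mono a b , &-mono a′ b′
ᴳ-ₒ-equivalent (A ⊕ B)  with ᴳ-ₒ-equivalent A | ᴳ-ₒ-equivalent B
... | a , a′ | b , b′ =
  -- Dereliction drops the additional `!` under `⁇`; for the converse, `!⊕!-promote` restores it.
  ⁇-mono (!L (⊕-mono (!-mono a) (!-mono b))) ,
  ⁇-mono (Entails-trans (⊕-mono (!-mono a′) (!-mono b′)) !⊕!-promote)
ᴳ-ₒ-equivalent (A ⊸ B)  with ᴳ-ₒ-equivalent A | ᴳ-ₒ-equivalent B
... | a , a′ | b , b′ = ⊸-mono (!-mono a′) b , ⊸-mono (!-mono a) b′
ᴳ-ₒ-equivalent (all A)  with ᴳ-ₒ-equivalent A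
... | a , a′ = all-mono a , all-mono a′
ᴳ-ₒ-equivalent (ex A)   with ᴳ-ₒ-equivalent A
... | a , a′ =
  ⁇-mono (!L (ex-mono (!-mono a))) ,
  ⁇-mono (Entails-trans (ex-mono (!-mono a′)) ex!-promote)
ᴳ-ₒ-equivalent (! A)    with ᴳ-ₒ-equivalent A
... | a , a′ = !-mono a , !-mono a′

theorem1 : (L : Signature) (A : Formula L) → ProvablyEquivalent CLLb ((A ᴳ) °) (! (A ᴳₒ))
theorem1 L A with ᴳ-ₒ-equivalent A
... | d , e = Equivalent⇒ProvablyEquivalent (!-mono d , !-mono e)
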